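{- A signed graph $G$ is $3$-critical if and only if $G$ is a balanced odd cycle or an unbalanced even cycle.
   Context: A signed graph is a finite graph (multiple edges allowed, no loops) with a sign map $\sigma$ assigning $\pm1$ to each edge. A coloring is a map $\phi:V\to\mathbb{Z}$ with $\phi(v)\ne\sigma(e)\phi(w)$ for every edge $e$ with ends $v,w$. With $Z_{2h}=\{\pm1,\dots,\pm h\}$ and $Z_{2h+1}=Z_{2h}\cup\{0\}$, $\chi^{\pm}(G)$ is the least $k$ such that $G$ has a coloring with values in $Z_k$. $G$ is $k$-critical if $\chi^{\pm}(G)=k$ and every proper signed subgraph $G'$ (sub-multigraph with inherited signs) satisfies $\chi^{\pm}(G')\le k-1$. A cycle is a signed graph whose underlying graph is a cycle (a cycle of length 2 consists of two parallel edges); it is balanced if its sign product (product of edge signs) is positive and unbalanced otherwise. -}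

module Defs where

open import Data.Nat as ℕ using (ℕ; zero; suc; _<_; _≤_)
open import Data.Integer as ℤ using (ℤ; ∣_∣; 0ℤ; 1ℤ; -1ℤ)
open import Data.Fin using (Fin; zero; suc)
open import Data.Fin.Base as Fin using ()
open import Data.Sign as Sign using (Sign)
open import Data.Bool using (Bool; true; false)
open import Data.List using (List; foldr; map; allFin)
open import Data.Product using (Σ; ∃; _×_; _,_; proj₁; proj₂)
open import Data.Sum using (_⊎_)
open import Relation.Binary.PropositionalEquality using (_≡_; _≢_)
open import Relation.Nullary using (¬_)
open import Function.Definitions using (Bijective)

-- Parity
Even : ℕ → Set
Even n = ∃ λ k → n ≡ 2 ℕ.* k

Odd : ℕ → Set
Odd n = ∃ λ k → n ≡ suc (2 ℕ.* k)

-- A finite signed multigraph without loops: vertices Fin n, edges Fin m,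
-- each edge has two (distinct) ends and a sign.
record SignedGraph : Set where
  field
    n      : ℕ
    m      : ℕ
    ends   : Fin m → Fin n × Fin n
    noLoop : ∀ e → proj₁ (ends e) ≢ proj₂ (ends e)
    sign   : Fin m → Sign

open SignedGraph public

-- value of a sign as an integer ±1
⟦_⟧ : Sign → ℤ
⟦ Sign.+ ⟧ = 1ℤ
⟦ Sign.- ⟧ = -1ℤ

-- x ∈ Z_k :  Z_{2h} = {±1,…,±h},  Z_{2h+1} = Z_{2h} ∪ {0}
InZ : ℕ → ℤ → Set
InZ k x = (∃ λ h → k ≡ 2 ℕ.* h × x ≢ 0ℤ × ∣ x ∣ ≤ h)
        ⊎ (∃ λ h → k ≡ suc (2 ℕ.* h) × ∣ x ∣ ≤ h)

-- A signed subgraph of G: a set of vertices and a set of edges whose ends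
-- are among the chosen vertices (signs inherited).
record Subgraph (G : SignedGraph) : Set where
  field
    vs     : Fin (n G) → Bool
    es     : Fin (m G) → Bool
    closed : ∀ e → es e ≡ true →
             vs (proj₁ (ends G e)) ≡ true × vs (proj₂ (ends G e)) ≡ true

open Subgraph public

-- the whole graph as a subgraph of itself
whole : (G : SignedGraph) → Subgraph G
whole G = record { vs = λ _ → true ; es = λ _ → true ; closed = λ _ _ → _≡_.refl , _≡_.refl }

-- H is a proper subgraph: it misses some vertex or some edge of G
Proper : {G : SignedGraph} → Subgraph G → Set
Proper {G} H = (∃ λ v → vs H v ≡ false) ⊎ (∃ λ e → es H e ≡ false)

-- φ is a coloring of the subgraph H with values in Z_k
-- (φ(v) ≠ σ(e) φ(w) for every edge e of H with ends v, w)
ColoringOf : {G : SignedGraph} → Subgraph G → ℕ → (Fin (n G) → ℤ) → Set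
ColoringOf {G} H k φ =
  (∀ v → vs H v ≡ true → InZ k (φ v)) ×
  (∀ e → es H e ≡ true →
     φ (proj₁ (ends G e)) ≢ ⟦ sign G e ⟧ ℤ.* φ (proj₂ (ends G e)))

Colorable : {G : SignedGraph} → Subgraph G → ℕ → Set
Colorable H k = ∃ λ φ → ColoringOf H k φ

-- χ±(H) = k : k is the least number with a Z_k-coloring
ChiEq : {G : SignedGraph} → Subgraph G → ℕ → Set
ChiEq H k = Colorable H k × (∀ j → j < k → ¬ Colorable H j)

-- χ±(H) ≤ k
ChiLe : {G : SignedGraph} → Subgraph G → ℕ → Set
ChiLe H k = ∃ λ j → j ≤ k × Colorable H j

-- G is k-critical
Critical : ℕ → SignedGraph → Set
Critical k G = ChiEq (whole G) k ×
  (∀ (H : Subgraph G) → Proper H → ChiLe H (k ℕ.∸ 1))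

-- G is a cycle of length ℓ (ℓ ≥ 2): vertices p 0,…,p (ℓ-1) and edges
-- q 0,…,q (ℓ-1) (both enumerations bijective), edge q i joining p i and p (i+1 mod ℓ).
nextMod : ∀ {ℓ} → Fin ℓ → Fin ℓ
nextMod {suc ℓ} i with Fin.toℕ i ℕ.<? ℓ
... | Relation.Nullary.yes p = Fin.fromℕ< (ℕ.s≤s p)
... | Relation.Nullary.no _ = zero

Joins : {N : ℕ} → Fin N × Fin N → Fin N → Fin N → Set
Joins (x , y) a b = (x ≡ a × y ≡ b) ⊎ (x ≡ b × y ≡ a)

IsCycleOfLength : SignedGraph → ℕ → Set
IsCycleOfLength G ℓ = 2 ≤ ℓ ×
  Σ (Fin ℓ → Fin (n G)) λ p → Bijective _≡_ _≡_ p ×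
  Σ (Fin ℓ → Fin (m G)) λ q → Bijective _≡_ _≡_ q ×
  (∀ i → Joins (ends G (q i)) (p i) (p (nextMod i)))

-- sign product of all edges
signProduct : SignedGraph → Sign
signProduct G = foldr Sign._*_ Sign.+ (map (sign G) (allFin (m G)))

Balanced : SignedGraph → Set
Balanced G = signProduct G ≡ Sign.+

Unbalanced : SignedGraph → Set
Unbalanced G = signProduct G ≡ Sign.-

BalancedOddCycle : SignedGraph → Set
BalancedOddCycle G = Balanced G × ∃ λ ℓ → IsCycleOfLength G ℓ × Odd ℓ

UnbalancedEvenCycle : SignedGraph → Set
UnbalancedEvenCycle G = Unbalanced G × ∃ λ ℓ → IsCycleOfLength G ℓ × Even ℓ

-- With colors ±1 the condition φ(v) ≠ σ(e) φ(w) says φ(v) = −σ(e) φ(w), so χ±(G) ≤ 2 iff every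
-- closed walk has positive product of −σ. A cycle of length ℓ has −σ-product (−1)^ℓ times its sign
-- product, so the cycles with negative −σ-product are exactly the balanced odd and the unbalanced
-- even cycles.
-- If G is 3-critical, a 2-coloring of G − e₀ violates e₀. Either a walk in G − e₀ joins the ends of
-- e₀, and closing it up with e₀ gives a closed walk of negative −σ-product, or the ends of e₀ are
-- separated and switching the coloring on one side repairs e₀. Shortcutting the walk gives a cycle C
-- of negative −σ-product; C is not 2-colorable, so by criticality it is all of G.
-- Conversely, such a cycle is not 2-colorable; deleting an edge leaves a path, which is 2-colored by
-- propagating −σ along it; and coloring one vertex 0 and the path left by its removal with ±1 gives
-- a 3-coloring.
module Submission where

open import Defs
open import Data.Nat as ℕ using (ℕ; zero; suc; _<_; _≤_; z≤n; s≤s; _+_; _∸_)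
import Data.Nat.Properties as ℕP
open import Data.Fin using (Fin; zero; suc; toℕ; fromℕ; inject₁)
import Data.Fin.Properties as FinP
open import Data.Integer as ℤ using (ℤ; +_; -[1+_]; ∣_∣; 0ℤ)
import Data.Integer.Properties as ℤP
open import Data.Sign as Sign using (Sign; opposite; _*_)
import Data.Sign.Properties as SignP
open import Data.Bool using (Bool; true; false; not; if_then_else_)
open import Data.Bool.Properties using (¬-not) renaming (_≟_ to _≟ᵇ_)
open import Data.Fin.Subset using (Subset; _∈_; _∉_; _⊂_; _⊃_; _∪_; ⁅_⁆)
open import Data.Fin.Subset.Properties using (_∈?_; x∈⁅x⁆; x∈⁅y⁆⇒x≡y; p⊆p∪q; q⊆p∪q; x∈p∪q⁻)
open import Data.Fin.Subset.Induction using (⊃-wellFounded)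
open import Induction.WellFounded using (Acc; acc)
open import Data.Nat.Induction using (<-wellFounded)
open import Data.List using (foldr; tabulate)
import Data.List.Properties as ListP
open import Data.Product using (Σ; ∃; _×_; _,_; proj₁; proj₂)
open import Data.Sum using (_⊎_; inj₁; inj₂; [_,_]′)
open import Data.Empty using (⊥-elim)
open import Relation.Binary.PropositionalEquality
open import Relation.Nullary using (¬_; Dec; yes; no; does)
open import Relation.Nullary.Decidable using (_×-dec_; _⊎-dec_; ¬?; dec-true; dec-false)
open import Relation.Nullary.Negation using (contradiction)
open import Function using (_∘_; id)
open import Function.Definitions using (Bijective; Injective; Surjective)
open import Function.Bundles using (_⇔_; mk⇔; mk⤖; Equivalence; Inverse)
open import Function.Properties.Bijection using (⤖⇒↔)
open import Function.Properties.Equivalence using () renaming (trans to ⇔-trans)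
open import Data.Fin.Permutation using (Permutation; permutation)
open import Algebra.Properties.CommutativeMonoid.Sum SignP.*-commutativeMonoid
  using (sum-permute; sum-cong-≗; ∑-distrib-+) renaming (sum to ∏)

-- Cyclic successor on Fin ℓ

nextMod-cases : ∀ {L} (i : Fin (suc L)) →
  (toℕ i < L × toℕ (nextMod i) ≡ suc (toℕ i)) ⊎ (toℕ i ≡ L × nextMod i ≡ zero)
nextMod-cases {L} i with toℕ i ℕ.<? L
... | yes i<L = inj₁ (i<L , FinP.toℕ-fromℕ< (s≤s i<L))
... | no  i≮L = inj₂ (ℕP.≤-antisym (ℕP.≤-pred (FinP.toℕ<n i)) (ℕP.≮⇒≥ i≮L) , refl)

nextMod-periodic : ∀ {A : Set} {ℓ} (f : ℕ → A) → f ℓ ≡ f 0 → (i : Fin ℓ) →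
                   f (toℕ (nextMod i)) ≡ f (suc (toℕ i))
nextMod-periodic {ℓ = suc L} f fℓ≡f0 i with nextMod-cases i
... | inj₁ (_ , i⁺)     = cong f i⁺
... | inj₂ (i≡L , i⁺)   = trans (cong (f ∘ toℕ) i⁺) (trans (sym fℓ≡f0) (cong (f ∘ suc) (sym i≡L)))

nextMod-injective : ∀ {ℓ} → Injective _≡_ _≡_ (nextMod {ℓ})
nextMod-injective {suc L} {i} {j} eq with nextMod-cases i | nextMod-cases j
... | inj₁ (_ , i⁺) | inj₁ (_ , j⁺) =
  FinP.toℕ-injective (ℕP.suc-injective (trans (sym i⁺) (trans (cong toℕ eq) j⁺)))
... | inj₂ (i≡L , _) | inj₂ (j≡L , _) = FinP.toℕ-injective (trans i≡L (sym j≡L))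
... | inj₁ (_ , i⁺) | inj₂ (_ , j⁺) with () ← trans (sym i⁺) (trans (cong toℕ eq) (cong toℕ j⁺))
... | inj₂ (_ , i⁺) | inj₁ (_ , j⁺) with () ← trans (sym j⁺) (trans (cong toℕ (sym eq)) (cong toℕ i⁺))

prevMod : ∀ {ℓ} → Fin ℓ → Fin ℓ
prevMod {suc L} zero    = fromℕ L
prevMod         (suc j) = inject₁ j

nextMod-prevMod : ∀ {ℓ} (j : Fin ℓ) → nextMod (prevMod j) ≡ j
nextMod-prevMod {suc L} zero with nextMod-cases (fromℕ L)
... | inj₁ (L<L , _) = contradiction (subst (_< L) (FinP.toℕ-fromℕ L) L<L) (ℕP.<-irrefl refl)
... | inj₂ (_ , eq) = eq
nextMod-prevMod {suc L} (suc j) with nextMod-cases (inject₁ j)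
... | inj₁ (_ , eq) = FinP.toℕ-injective (trans eq (cong suc (FinP.toℕ-inject₁ j)))
... | inj₂ (j≡L , _) =
  contradiction (subst (_< L) (trans (sym (FinP.toℕ-inject₁ j)) j≡L) (FinP.toℕ<n j)) (ℕP.<-irrefl refl)

nextMod-permutation : ∀ {ℓ} → Permutation ℓ ℓ
nextMod-permutation = permutation nextMod prevMod nextMod-prevMod
  (λ i → nextMod-injective (nextMod-prevMod (nextMod i)))

nextMod²≡id⇒ℓ≤2 : ∀ {ℓ} (i : Fin ℓ) → nextMod (nextMod i) ≡ i → ℓ ≤ 2
nextMod²≡id⇒ℓ≤2 {suc L} i eq with nextMod-cases i
... | inj₂ (i≡L , i⁺) with nextMod-cases {L} zero
...   | inj₁ (_ , 0⁺) =
  s≤s (ℕP.≤-reflexive (trans (sym i≡L) (trans (cong toℕ (sym eq)) (trans (cong (toℕ ∘ nextMod) i⁺) 0⁺))))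
...   | inj₂ (0≡L , _) = s≤s (subst (_≤ 1) 0≡L z≤n)
nextMod²≡id⇒ℓ≤2 {suc L} i eq | inj₁ (_ , i⁺) with nextMod-cases (nextMod i)
... | inj₁ (_ , i⁺⁺) = contradiction (trans (cong toℕ (sym eq)) (trans i⁺⁺ (cong suc i⁺))) no-2-cycle
  where
  no-2-cycle : ∀ {x} → x ≢ suc (suc x)
  no-2-cycle ()
... | inj₂ (i⁺≡L , i⁺⁺) =
  s≤s (ℕP.≤-reflexive (trans (sym i⁺≡L) (trans i⁺ (cong (suc ∘ toℕ) (trans (sym eq) i⁺⁺)))))

∸-suc : ∀ {m n} → n < m → m ∸ n ≡ suc (m ∸ suc n)
∸-suc {suc m} {zero}  _          = refl
∸-suc {suc m} {suc n} (s≤s n<m) = ∸-suc n<m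

-- number of steps from I to K along 0 → 1 → ⋯ → ℓ-1 → 0
gapℕ : ℕ → ℕ → ℕ → ℕ
gapℕ ℓ K I with I ℕ.≤? K
... | yes _ = K ∸ I
... | no  _ = ℓ ∸ I + K

gap : ∀ {ℓ} → Fin ℓ → Fin ℓ → ℕ
gap {ℓ} k i = gapℕ ℓ (toℕ k) (toℕ i)

gap-nextMod : ∀ {ℓ} (k i : Fin ℓ) → i ≢ k → gap k i ≡ suc (gap k (nextMod i))
gap-nextMod {suc L} k i i≢k with nextMod-cases i
... | inj₁ (i<L , i⁺) rewrite i⁺ = step (toℕ i) (s≤s i<L) (i≢k ∘ FinP.toℕ-injective)
  where
  step : ∀ I → suc I < suc L → I ≢ toℕ k →
         gapℕ (suc L) (toℕ k) I ≡ suc (gapℕ (suc L) (toℕ k) (suc I))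
  step I I⁺<ℓ I≢K with I ℕ.≤? toℕ k | suc I ℕ.≤? toℕ k
  ... | yes _   | yes I<K = ∸-suc I<K
  ... | yes I≤K | no  I≮K = contradiction (ℕP.≤∧≢⇒< I≤K I≢K) I≮K
  ... | no  I≰K | yes I<K = contradiction (ℕP.<⇒≤ I<K) I≰K
  ... | no  _   | no  _   = cong (_+ toℕ k) (∸-suc (ℕP.<-trans (ℕP.n<1+n I) I⁺<ℓ))
... | inj₂ (i≡L , i⁺) rewrite i⁺ = trans (cong (gapℕ (suc L) (toℕ k)) i≡L) wrap
  where
  k<L : toℕ k < L
  k<L = ℕP.≤∧≢⇒< (ℕP.≤-pred (FinP.toℕ<n k))
                  (λ k≡L → i≢k (FinP.toℕ-injective (trans i≡L (sym k≡L))))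
  wrap : gapℕ (suc L) (toℕ k) L ≡ suc (gapℕ (suc L) (toℕ k) 0)
  wrap with L ℕ.≤? toℕ k
  ... | yes L≤k = contradiction k<L (ℕP.≤⇒≯ L≤k)
  ... | no  _   = cong (_+ toℕ k) (trans (∸-suc (ℕP.n<1+n L)) (cong suc (ℕP.n∸n≡0 L)))

-- Signs

≢⇒≡opposite : ∀ {x y : Sign} → x ≢ y → x ≡ opposite y
≢⇒≡opposite {Sign.+} {Sign.+} x≢y = contradiction refl x≢y
≢⇒≡opposite {Sign.+} {Sign.-} _   = refl
≢⇒≡opposite {Sign.-} {Sign.+} _   = refl
≢⇒≡opposite {Sign.-} {Sign.-} x≢y = contradiction refl x≢y

opposite-*ˡ : ∀ s t → opposite (s * t) ≡ opposite s * t
opposite-*ˡ Sign.+ t = refl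
opposite-*ˡ Sign.- t = SignP.opposite-involutive t

opposite-*ʳ : ∀ s t → opposite (s * t) ≡ s * opposite t
opposite-*ʳ Sign.+ t = refl
opposite-*ʳ Sign.- t = refl

≢*⇔≡opposite* : ∀ x s y → (x ≢ s * y) ⇔ (x ≡ opposite s * y)
≢*⇔≡opposite* x s y = mk⇔
  (λ x≢sy → trans (≢⇒≡opposite x≢sy) (opposite-*ˡ s y))
  (λ x≡s̄y x≡sy → SignP.s≢opposite[s] (s * y)
                    (trans (sym x≡sy) (trans x≡s̄y (sym (opposite-*ˡ s y)))))

unbalanced-closing : ∀ {x y} t w → x ≡ w * y → y ≢ t * x → t * w ≡ Sign.-
unbalanced-closing {x} {y} t w x≡wy y≢tx = ≢⇒≡opposite λ tw≡+ → y≢tx (begin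
  y           ≡⟨ cong (_* y) tw≡+ ⟨
  (t * w) * y ≡⟨ SignP.*-assoc t w y ⟩
  t * (w * y) ≡⟨ cong (t *_) x≡wy ⟨
  t * x       ∎)
  where open ≡-Reasoning

≡*-sym : ∀ {x y} s → x ≡ s * y → y ≡ s * x
≡*-sym {x} {y} s x≡sy = begin
  y           ≡⟨ cong (_* y) (SignP.s*s≡+ s) ⟨
  (s * s) * y ≡⟨ SignP.*-assoc s s y ⟩
  s * (s * y) ≡⟨ cong (s *_) x≡sy ⟨
  s * x       ∎
  where open ≡-Reasoning

-^_ : ℕ → Sign
-^ zero  = Sign.+
-^ suc k = opposite (-^ k)

∏-opposite : ∀ {k} (f : Fin k → Sign) → ∏ (opposite ∘ f) ≡ -^ k * ∏ f
∏-opposite {zero}  f = refl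
∏-opposite {suc k} f = trans (cong (opposite (f zero) *_) (∏-opposite (f ∘ suc)))
                             (exchange (f zero) (-^ k) (∏ (f ∘ suc)))
  where
  exchange : ∀ x y z → opposite x * (y * z) ≡ opposite y * (x * z)
  exchange Sign.+ Sign.+ z = refl
  exchange Sign.+ Sign.- z = SignP.opposite-involutive z
  exchange Sign.- Sign.+ z = sym (SignP.opposite-involutive z)
  exchange Sign.- Sign.- z = refl

-^-even : ∀ h → -^ (2 ℕ.* h) ≡ Sign.+
-^-even zero    = refl
-^-even (suc h) = begin
  -^ (2 ℕ.* suc h)                    ≡⟨ cong -^_ (ℕP.*-suc 2 h) ⟩
  opposite (opposite (-^ (2 ℕ.* h)))  ≡⟨ SignP.opposite-involutive _ ⟩
  -^ (2 ℕ.* h)                        ≡⟨ -^-even h ⟩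
  Sign.+                              ∎
  where open ≡-Reasoning

even⊎odd : ∀ n → Even n ⊎ Odd n
even⊎odd zero = inj₁ (0 , refl)
even⊎odd (suc n) with even⊎odd n
... | inj₁ (h , refl) = inj₂ (h , refl)
... | inj₂ (h , refl) = inj₁ (suc h , cong suc (sym (ℕP.+-suc h (h + 0))))

-^*≡-⇔ : ∀ ℓ x → (-^ ℓ * x ≡ Sign.-) ⇔ ((Odd ℓ × x ≡ Sign.+) ⊎ (Even ℓ × x ≡ Sign.-))
-^*≡-⇔ ℓ x = mk⇔ to from
  where
  to : -^ ℓ * x ≡ Sign.- → (Odd ℓ × x ≡ Sign.+) ⊎ (Even ℓ × x ≡ Sign.-)
  to eq with even⊎odd ℓ
  ... | inj₁ (h , refl) = inj₂ ((h , refl) , trans (cong (_* x) (sym (-^-even h))) eq)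
  ... | inj₂ (h , refl) = inj₁ ((h , refl) , SignP.opposite-injective
                                  (trans (cong (λ s → opposite s * x) (sym (-^-even h))) eq))
  from : (Odd ℓ × x ≡ Sign.+) ⊎ (Even ℓ × x ≡ Sign.-) → -^ ℓ * x ≡ Sign.-
  from (inj₁ ((h , refl) , refl)) = cong (λ s → opposite s * Sign.+) (-^-even h)
  from (inj₂ ((h , refl) , refl)) = cong (_* Sign.-) (-^-even h)

∏-bijection : ∀ {k ℓ} (f : Fin k → Sign) {q : Fin ℓ → Fin k} → Bijective _≡_ _≡_ q →
              ∏ (f ∘ q) ≡ ∏ f
∏-bijection f q-bij = sym (sum-permute f (⤖⇒↔ (mk⤖ q-bij)))

signProduct≡∏ : ∀ G → signProduct G ≡ ∏ (sign G)
signProduct≡∏ G =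
  trans (cong (foldr _*_ Sign.+) (ListP.map-tabulate id (sign G))) (foldr-tabulate (sign G))
  where
  foldr-tabulate : ∀ {k} (f : Fin k → Sign) → foldr _*_ Sign.+ (tabulate f) ≡ ∏ f
  foldr-tabulate {zero}  f = refl
  foldr-tabulate {suc k} f = cong (f zero *_) (foldr-tabulate (f ∘ suc))

∏-nextMod : ∀ {ℓ} (f : Fin ℓ → Sign) → ∏ (f ∘ nextMod) ≡ ∏ f
∏-nextMod f = sym (sum-permute f nextMod-permutation)

∏-pair : (f : Fin 2 → Sign) → f zero ≡ f (suc zero) → ∏ f ≡ Sign.+
∏-pair f f0≡f1 = begin
  f zero * (f (suc zero) * Sign.+)  ≡⟨ cong₂ _*_ f0≡f1 (SignP.*-identityʳ (f (suc zero))) ⟩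
  f (suc zero) * f (suc zero)       ≡⟨ SignP.s*s≡+ (f (suc zero)) ⟩
  Sign.+                            ∎
  where open ≡-Reasoning

∏-repeated : ∀ {ℓ} (f : Fin ℓ → Sign) → ℓ ≡ 2 → ∀ {i j} → i ≢ j → f i ≡ f j → ∏ f ≡ Sign.+
∏-repeated f refl {zero}     {zero}     i≢j _   = contradiction refl i≢j
∏-repeated f refl {zero}     {suc zero} _   eq  = ∏-pair f eq
∏-repeated f refl {suc zero} {zero}     _   eq  = ∏-pair f (sym eq)
∏-repeated f refl {suc zero} {suc zero} i≢j _   = contradiction refl i≢j

-- Values in Z_k

∣x∣≤0⇒x≡0 : ∀ {x} → ∣ x ∣ ≤ 0 → x ≡ 0ℤ
∣x∣≤0⇒x≡0 = ℤP.∣i∣≡0⇒i≡0 ∘ ℕP.n≤0⇒n≡0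

InZ-0 : ∀ {x} → ¬ InZ 0 x
InZ-0 (inj₁ (zero , _ , x≢0 , ∣x∣≤0)) = x≢0 (∣x∣≤0⇒x≡0 ∣x∣≤0)

InZ-1 : ∀ {x} → InZ 1 x → x ≡ 0ℤ
InZ-1 (inj₁ (suc h , 1≡2h , _)) = contradiction (sym (ℕP.suc-injective 1≡2h)) (ℕP.m+1+n≢0 h)
InZ-1 (inj₂ (zero , _ , ∣x∣≤0))  = ∣x∣≤0⇒x≡0 ∣x∣≤0

InZ-2 : ∀ {x} → InZ 2 x → ⟦ ℤ.sign x ⟧ ≡ x
InZ-2 {x} (inj₁ (h , 2≡2h , x≢0 , ∣x∣≤h)) =
  unit x≢0 (subst (∣ x ∣ ≤_) (sym (ℕP.*-cancelˡ-≡ 1 h 2 2≡2h)) ∣x∣≤h)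
  where
  unit : ∀ {x} → x ≢ 0ℤ → ∣ x ∣ ≤ 1 → ⟦ ℤ.sign x ⟧ ≡ x
  unit {+ zero}         x≢0 _         = contradiction refl x≢0
  unit {+ suc zero}     _   _         = refl
  unit {+ suc (suc _)}  _   (s≤s ())
  unit { -[1+ zero ]}   _   _         = refl
  unit { -[1+ suc _ ]}  _   (s≤s ())
InZ-2 (inj₂ (suc h , 2≡1+2h , _)) =
  contradiction (sym (ℕP.suc-injective (ℕP.suc-injective 2≡1+2h))) (ℕP.m+1+n≢0 h)

⟦⟧-InZ-2 : ∀ s → InZ 2 ⟦ s ⟧
⟦⟧-InZ-2 Sign.+ = inj₁ (1 , refl , (λ ()) , s≤s z≤n)
⟦⟧-InZ-2 Sign.- = inj₁ (1 , refl , (λ ()) , s≤s z≤n)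

⟦⟧-InZ-3 : ∀ s → InZ 3 ⟦ s ⟧
⟦⟧-InZ-3 Sign.+ = inj₂ (1 , refl , s≤s z≤n)
⟦⟧-InZ-3 Sign.- = inj₂ (1 , refl , s≤s z≤n)

0-InZ-3 : InZ 3 0ℤ
0-InZ-3 = inj₂ (1 , refl , z≤n)

⟦⟧-* : ∀ s t → ⟦ s * t ⟧ ≡ ⟦ s ⟧ ℤ.* ⟦ t ⟧
⟦⟧-* Sign.+ Sign.+ = refl
⟦⟧-* Sign.+ Sign.- = refl
⟦⟧-* Sign.- Sign.+ = refl
⟦⟧-* Sign.- Sign.- = refl

⟦⟧-injective : ∀ {s t} → ⟦ s ⟧ ≡ ⟦ t ⟧ → s ≡ t
⟦⟧-injective {Sign.+} {Sign.+} _ = refl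
⟦⟧-injective {Sign.-} {Sign.-} _ = refl

⟦⟧≢0 : ∀ s → ⟦ s ⟧ ≢ 0ℤ
⟦⟧≢0 Sign.+ ()
⟦⟧≢0 Sign.- ()

-- Signed graphs

does-true : ∀ {A : Set} (d : Dec A) → does d ≡ true → A
does-true (yes a) _ = a

Fin? : ∀ k → Dec (Fin k)
Fin? zero    = no λ ()
Fin? (suc k) = yes zero

joins-unique : ∀ {N} {x : Fin N × Fin N} {a b c d} → Joins x a b → Joins x c d →
               (a ≡ c × b ≡ d) ⊎ (a ≡ d × b ≡ c)
joins-unique (inj₁ (refl , refl)) (inj₁ (refl , refl)) = inj₁ (refl , refl)
joins-unique (inj₁ (refl , refl)) (inj₂ (refl , refl)) = inj₂ (refl , refl)
joins-unique (inj₂ (refl , refl)) (inj₁ (refl , refl)) = inj₂ (refl , refl)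
joins-unique (inj₂ (refl , refl)) (inj₂ (refl , refl)) = inj₁ (refl , refl)

module _ (G : SignedGraph) where

  private
    V = Fin (n G)
    E = Fin (m G)

  fst snd : E → V
  fst e = proj₁ (ends G e)
  snd e = proj₂ (ends G e)

  antisign : E → Sign
  antisign e = opposite (sign G e)

  Respects : (V → Sign) → E → Set
  Respects s e = s (fst e) ≡ antisign e * s (snd e)

  SignColoring : Subgraph G → (V → Sign) → Set
  SignColoring H s = ∀ e → es H e ≡ true → Respects s e

  SignColorable : Subgraph G → Set
  SignColorable H = ∃ (SignColoring H)

  respects-joins : ∀ {s e a b} → Respects s e → Joins (ends G e) a b → s a ≡ antisign e * s b
  respects-joins         s-ok (inj₁ (refl , refl)) = s-ok
  respects-joins {e = e} s-ok (inj₂ (refl , refl)) = ≡*-sym (antisign e) s-ok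

  joins⇒respects : ∀ {s e a b} → Joins (ends G e) a b → s a ≡ antisign e * s b → Respects s e
  joins⇒respects         (inj₁ (refl , refl)) eq = eq
  joins⇒respects {e = e} (inj₂ (refl , refl)) eq = ≡*-sym (antisign e) eq

  signColoring⇒coloring : ∀ {H s} → SignColoring H s → ColoringOf H 2 (⟦_⟧ ∘ s)
  signColoring⇒coloring {H} {s} s-ok = (λ v _ → ⟦⟧-InZ-2 (s v)) , proper
    where
    proper : ∀ e → es H e ≡ true → ⟦ s (fst e) ⟧ ≢ ⟦ sign G e ⟧ ℤ.* ⟦ s (snd e) ⟧
    proper e e∈H eq = Equivalence.from (≢*⇔≡opposite* _ (sign G e) _) (s-ok e e∈H)
                        (⟦⟧-injective (trans eq (sym (⟦⟧-* (sign G e) (s (snd e))))))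

  colorable⇒signColorable : ∀ {H j} → j ≤ 2 → Colorable H j → SignColorable H
  colorable⇒signColorable {H} {zero} _ (φ , φ∈Z , _) =
    (λ _ → Sign.+) , λ e e∈H → ⊥-elim (InZ-0 (φ∈Z _ (proj₁ (closed H e e∈H))))
  colorable⇒signColorable {H} {suc zero} _ (φ , φ∈Z , φ-ok) =
    (λ _ → Sign.+) , λ e e∈H → ⊥-elim (φ-ok e e∈H (zero-edge e e∈H))
    where
    zero-edge : ∀ e → es H e ≡ true → φ (fst e) ≡ ⟦ sign G e ⟧ ℤ.* φ (snd e)
    zero-edge e e∈H
      rewrite InZ-1 (φ∈Z _ (proj₁ (closed H e e∈H))) | InZ-1 (φ∈Z _ (proj₂ (closed H e e∈H))) =
      sym (ℤP.*-zeroʳ ⟦ sign G e ⟧)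
  colorable⇒signColorable {H} {suc (suc zero)} _ (φ , φ∈Z , φ-ok) = s , s-ok
    where
    s : V → Sign
    s = ℤ.sign ∘ φ
    s-ok : SignColoring H s
    s-ok e e∈H = Equivalence.to (≢*⇔≡opposite* _ (sign G e) _) λ eq → φ-ok e e∈H (begin
      φ (fst e)                       ≡⟨ InZ-2 (φ∈Z _ (proj₁ (closed H e e∈H))) ⟨
      ⟦ s (fst e) ⟧                   ≡⟨ cong ⟦_⟧ eq ⟩
      ⟦ sign G e * s (snd e) ⟧        ≡⟨ ⟦⟧-* (sign G e) (s (snd e)) ⟩
      ⟦ sign G e ⟧ ℤ.* ⟦ s (snd e) ⟧
        ≡⟨ cong (⟦ sign G e ⟧ ℤ.*_) (InZ-2 (φ∈Z _ (proj₂ (closed H e e∈H)))) ⟩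
      ⟦ sign G e ⟧ ℤ.* φ (snd e)      ∎)
      where open ≡-Reasoning
  colorable⇒signColorable {j = suc (suc (suc _))} (s≤s (s≤s ())) _

  SignCritical : Set
  SignCritical = ¬ SignColorable (whole G) × (∀ H → Proper H → SignColorable H)

  critical⇒signCritical : Critical 3 G → SignCritical
  critical⇒signCritical ((_ , below3) , proper≤2) = not-2-colorable , proper-2-colorable
    where
    not-2-colorable : ¬ SignColorable (whole G)
    not-2-colorable (s , s-ok) =
      below3 2 (s≤s (s≤s (s≤s z≤n))) (⟦_⟧ ∘ s , signColoring⇒coloring {whole G} s-ok)
    proper-2-colorable : ∀ H → Proper H → SignColorable H
    proper-2-colorable H H-proper with proper≤2 H H-proper
    ... | j , j≤2 , H-colorable = colorable⇒signColorable {H} j≤2 H-colorable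

  -- Switching

  Crosses : Subset (n G) → E → Set
  Crosses S e = (fst e ∈ S × snd e ∉ S) ⊎ (snd e ∈ S × fst e ∉ S)

  switch : Subset (n G) → (V → Sign) → V → Sign
  switch S s v = if does (v ∈? S) then opposite (s v) else s v

  switch-respects : ∀ S s e → Respects s e → ¬ Crosses S e → Respects (switch S s) e
  switch-respects S s e s-ok no-cross with fst e ∈? S | snd e ∈? S
  ... | yes _    | yes _    = trans (cong opposite s-ok) (opposite-*ʳ (antisign e) (s (snd e)))
  ... | no  _    | no  _    = s-ok
  ... | yes u∈S  | no  v∉S  = contradiction (inj₁ (u∈S , v∉S)) no-cross
  ... | no  u∉S  | yes v∈S  = contradiction (inj₂ (v∈S , u∉S)) no-cross

  switch-repairs : ∀ S s e → ¬ Respects s e → Crosses S e → Respects (switch S s) e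
  switch-repairs S s e s-bad cross with fst e ∈? S | snd e ∈? S
  ... | yes _   | no  _   = trans (cong opposite (≢⇒≡opposite s-bad)) (SignP.opposite-involutive _)
  ... | no  _   | yes _   = trans (≢⇒≡opposite s-bad) (opposite-*ʳ (antisign e) (s (snd e)))
  ... | yes u∈S | yes v∈S = ⊥-elim ([ (λ (_ , v∉S) → v∉S v∈S) , (λ (_ , u∉S) → u∉S u∈S) ]′ cross)
  ... | no  u∉S | no  v∉S = ⊥-elim ([ (λ (u∈S , _) → u∉S u∈S) , (λ (v∈S , _) → v∉S v∈S) ]′ cross)

  -- Walks

  data Walk (H : Subgraph G) : V → V → Set where
    []   : ∀ {a} → Walk H a a
    step : ∀ {a b c} (e : E) → es H e ≡ true → Joins (ends G e) a b → Walk H b c → Walk H a c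

  module _ {H : Subgraph G} where

    length : ∀ {a c} → Walk H a c → ℕ
    length []             = 0
    length (step _ _ _ w) = suc (length w)

    walkSign : ∀ {a c} → Walk H a c → Sign
    walkSign []             = Sign.+
    walkSign (step e _ _ w) = antisign e * walkSign w

    _++_ : ∀ {a b c} → Walk H a b → Walk H b c → Walk H a c
    []           ++ w′ = w′
    step e h j w ++ w′ = step e h j (w ++ w′)

    length-++ : ∀ {a b c} (w : Walk H a b) (w′ : Walk H b c) →
                length (w ++ w′) ≡ length w + length w′
    length-++ []             w′ = refl
    length-++ (step _ _ _ w) w′ = cong suc (length-++ w w′)

    walkSign-++ : ∀ {a b c} (w : Walk H a b) (w′ : Walk H b c) →
                  walkSign (w ++ w′) ≡ walkSign w * walkSign w′
    walkSign-++ []             w′ = refl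
    walkSign-++ (step e _ _ w) w′ = trans (cong (antisign e *_) (walkSign-++ w w′))
                                          (sym (SignP.*-assoc (antisign e) (walkSign w) (walkSign w′)))

    walkSign-respected : ∀ {s} → SignColoring H s → ∀ {a c} (w : Walk H a c) → s a ≡ walkSign w * s c
    walkSign-respected s-ok []                    = refl
    walkSign-respected {s} s-ok (step e e∈H j w) = begin
      _                              ≡⟨ respects-joins (s-ok e e∈H) j ⟩
      antisign e * s _                ≡⟨ cong (antisign e *_) (walkSign-respected s-ok w) ⟩
      antisign e * (walkSign w * s _) ≡⟨ SignP.*-assoc (antisign e) (walkSign w) _ ⟨
      antisign e * walkSign w * s _   ∎
      where open ≡-Reasoning

    vertexAt : ∀ {a c} → Walk H a c → ℕ → V
    vertexAt {a} []             _       = a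
    vertexAt {a} (step _ _ _ _) zero    = a
    vertexAt     (step _ _ _ w) (suc i) = vertexAt w i

    edgeAt : ∀ {a c} (w : Walk H a c) → Fin (length w) → E
    edgeAt (step e _ _ _) zero    = e
    edgeAt (step _ _ _ w) (suc i) = edgeAt w i

    vertexAt-0 : ∀ {a c} (w : Walk H a c) → vertexAt w 0 ≡ a
    vertexAt-0 []             = refl
    vertexAt-0 (step _ _ _ _) = refl

    vertexAt-length : ∀ {a c} (w : Walk H a c) → vertexAt w (length w) ≡ c
    vertexAt-length []             = refl
    vertexAt-length (step _ _ _ w) = vertexAt-length w

    edgeAt-joins : ∀ {a c} (w : Walk H a c) (i : Fin (length w)) →
                   Joins (ends G (edgeAt w i)) (vertexAt w (toℕ i)) (vertexAt w (suc (toℕ i)))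
    edgeAt-joins (step e _ j w) zero    = subst (Joins (ends G e) _) (sym (vertexAt-0 w)) j
    edgeAt-joins (step _ _ _ w) (suc i) = edgeAt-joins w i

    walkSign≡∏ : ∀ {a c} (w : Walk H a c) → walkSign w ≡ ∏ (antisign ∘ edgeAt w)
    walkSign≡∏ []             = refl
    walkSign≡∏ (step e _ _ w) = cong (antisign e *_) (walkSign≡∏ w)

    -- the vertices before the last one are distinct (for a closed walk: it is a cycle)
    Simple : ∀ {a c} → Walk H a c → Set
    Simple w = Injective _≡_ _≡_ (vertexAt w ∘ toℕ {length w})

    splitAt : ∀ {a c} (w : Walk H a c) k → k ≤ length w → ∀ {x} → vertexAt w k ≡ x →
              Σ (Walk H a x) λ w₁ → Σ (Walk H x c) λ w₂ → w ≡ w₁ ++ w₂ × length w₁ ≡ k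
    splitAt []             zero    _         refl = [] , [] , refl , refl
    splitAt (step e h j w) zero    _         refl = [] , step e h j w , refl , refl
    splitAt (step e h j w) (suc k) (s≤s k≤n) w[k]≡x with splitAt w k k≤n w[k]≡x
    ... | w₁ , w₂ , refl , refl = step e h j w₁ , w₂ , refl , refl

    Shortcut : ∀ {a c} → Walk H a c → Set
    Shortcut {a} {c} w = Σ V λ x → Σ (Walk H a x) λ u → Σ (Walk H x x) λ loop → Σ (Walk H x c) λ v →
                         w ≡ u ++ (loop ++ v) × 0 < length loop × 0 < length v

    simple⊎shortcut : ∀ {a c} (w : Walk H a c) → Simple w ⊎ Shortcut w
    simple⊎shortcut []             = inj₁ λ { {()} }
    simple⊎shortcut (step e h j w) with simple⊎shortcut w
    ... | inj₂ (x , u , loop , v , refl , loop>0 , v>0) =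
      inj₂ (x , step e h j u , loop , v , refl , loop>0 , v>0)
    ... | inj₁ w-simple with FinP.any? (λ i → vertexAt w (toℕ i) FinP.≟ vertexAt (step e h j w) 0)
    ... | yes (i , returns) with splitAt w (toℕ i) (ℕP.<⇒≤ (FinP.toℕ<n i)) returns
    ... | w₁ , w₂ , refl , |w₁|≡i = inj₂ (_ , [] , step e h j w₁ , w₂ , refl , s≤s z≤n , w₂>0)
      where
      w₂>0 : 0 < length w₂
      w₂>0 = ℕP.+-cancelˡ-< (length w₁) 0 (length w₂) (begin-strict
        length w₁ + 0          ≡⟨ ℕP.+-identityʳ (length w₁) ⟩
        length w₁              ≡⟨ |w₁|≡i ⟩
        toℕ i                  <⟨ FinP.toℕ<n i ⟩
        length (w₁ ++ w₂)      ≡⟨ length-++ w₁ w₂ ⟩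
        length w₁ + length w₂  ∎)
        where open ℕP.≤-Reasoning
    simple⊎shortcut (step e h j w) | inj₁ w-simple | no never-returns = inj₁ simple
      where
      simple : Simple (step e h j w)
      simple {zero}  {zero}  _  = refl
      simple {zero}  {suc i} eq = contradiction (i , sym eq) never-returns
      simple {suc i} {zero}  eq = contradiction (i , eq) never-returns
      simple {suc i} {suc j} eq = cong suc (w-simple eq)

    SimpleUnbalancedClosedWalk : Set
    SimpleUnbalancedClosedWalk = Σ V λ b → Σ (Walk H b b) λ w → walkSign w ≡ Sign.- × Simple w

    simpleUnbalanced : ∀ {a} (w : Walk H a a) → walkSign w ≡ Sign.- → SimpleUnbalancedClosedWalk
    simpleUnbalanced w = go w (<-wellFounded (length w))
      where
      go : ∀ {a} (w : Walk H a a) → Acc _<_ (length w) → walkSign w ≡ Sign.- → SimpleUnbalancedClosedWalk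
      go w (acc shorter) w- with simple⊎shortcut w
      ... | inj₁ w-simple = _ , w , w- , w-simple
      ... | inj₂ (x , u , loop , v , refl , loop>0 , v>0) with walkSign loop in loop-sign
      ... | Sign.- = go loop (shorter loop-shorter) loop-sign
        where
        loop-shorter : length loop < length (u ++ (loop ++ v))
        loop-shorter rewrite length-++ u (loop ++ v) | length-++ loop v =
          ℕP.<-≤-trans (ℕP.m<m+n (length loop) v>0) (ℕP.m≤n+m _ (length u))
      ... | Sign.+ = go (u ++ v) (shorter rest-shorter) rest-sign
        where
        rest-shorter : length (u ++ v) < length (u ++ (loop ++ v))
        rest-shorter rewrite length-++ u (loop ++ v) | length-++ loop v | length-++ u v =
          ℕP.+-monoʳ-< (length u) (ℕP.m<n+m (length v) loop>0)
        rest-sign : walkSign (u ++ v) ≡ Sign.-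
        rest-sign = begin
          walkSign (u ++ v)                          ≡⟨ walkSign-++ u v ⟩
          walkSign u * walkSign v
            ≡⟨ cong (λ t → walkSign u * (t * walkSign v)) loop-sign ⟨
          walkSign u * (walkSign loop * walkSign v)  ≡⟨ cong (walkSign u *_) (walkSign-++ loop v) ⟨
          walkSign u * walkSign (loop ++ v)          ≡⟨ walkSign-++ u (loop ++ v) ⟨
          walkSign (u ++ (loop ++ v))                ≡⟨ w- ⟩
          Sign.-                                     ∎
          where open ≡-Reasoning

  weaken : ∀ {H a c} → Walk H a c → Walk (whole G) a c
  weaken []             = []
  weaken (step e _ j w) = step e refl j (weaken w)

  walkSign-weaken : ∀ {H a c} (w : Walk H a c) → walkSign (weaken w) ≡ walkSign w
  walkSign-weaken []             = refl
  walkSign-weaken (step e _ _ w) = cong (antisign e *_) (walkSign-weaken w)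

  Separates : Subgraph G → V → V → Subset (n G) → Set
  Separates H a b S = a ∈ S × b ∉ S × (∀ e → es H e ≡ true → ¬ Crosses S e)

  walk⊎separator : (H : Subgraph G) (a b : V) → Walk H a b ⊎ ∃ (Separates H a b)
  walk⊎separator H a b = grow ⁅ a ⁆ (⊃-wellFounded ⁅ a ⁆) (x∈⁅x⁆ a) from-a
    where
    Reached : Subset (n G) → Set
    Reached S = ∀ {v} → v ∈ S → Walk H a v

    from-a : Reached ⁅ a ⁆
    from-a v∈⁅a⁆ rewrite x∈⁅y⁆⇒x≡y a v∈⁅a⁆ = []

    crosses? : ∀ S e → Dec (Crosses S e)
    crosses? S e = (fst e ∈? S ×-dec ¬? (snd e ∈? S)) ⊎-dec (snd e ∈? S ×-dec ¬? (fst e ∈? S))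

    leave : ∀ {S e} → Crosses S e → Σ V λ u → Σ V λ v → u ∈ S × v ∉ S × Joins (ends G e) u v
    leave (inj₁ (u∈S , v∉S)) = _ , _ , u∈S , v∉S , inj₁ (refl , refl)
    leave (inj₂ (v∈S , u∉S)) = _ , _ , v∈S , u∉S , inj₂ (refl , refl)

    grow : ∀ S → Acc _⊃_ S → a ∈ S → Reached S → Walk H a b ⊎ ∃ (Separates H a b)
    grow S (acc larger) a∈S reached with b ∈? S
    ... | yes b∈S = inj₁ (reached b∈S)
    ... | no  b∉S with FinP.any? (λ e → (es H e ≟ᵇ true) ×-dec crosses? S e)
    ... | no  none = inj₂ (S , a∈S , b∉S , λ e e∈H cross → none (e , e∈H , cross))
    ... | yes (e , e∈H , cross) with leave cross
    ... | u , v , u∈S , v∉S , j =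
      grow (S ∪ ⁅ v ⁆) (larger S⊂S∪⁅v⁆) (p⊆p∪q ⁅ v ⁆ a∈S) reached′
      where
      S⊂S∪⁅v⁆ : S ⊂ S ∪ ⁅ v ⁆
      S⊂S∪⁅v⁆ = p⊆p∪q ⁅ v ⁆ , v , q⊆p∪q S ⁅ v ⁆ (x∈⁅x⁆ v) , v∉S
      reached′ : Reached (S ∪ ⁅ v ⁆)
      reached′ x∈S∪⁅v⁆ with x∈p∪q⁻ S ⁅ v ⁆ x∈S∪⁅v⁆
      ... | inj₁ x∈S   = reached x∈S
      ... | inj₂ x∈⁅v⁆ rewrite x∈⁅y⁆⇒x≡y v x∈⁅v⁆ = reached u∈S ++ step e e∈H j []

  deleteEdge : E → Subgraph G
  deleteEdge e₀ = record
    { vs = λ _ → true ; es = λ e → not (does (e FinP.≟ e₀)) ; closed = λ _ _ → refl , refl }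

  deleteEdge-proper : ∀ e₀ → Proper (deleteEdge e₀)
  deleteEdge-proper e₀ = inj₂ (e₀ , cong not (dec-true (e₀ FinP.≟ e₀) refl))

  ∈-deleteEdge : ∀ {e₀ e} → e ≢ e₀ → es (deleteEdge e₀) e ≡ true
  ∈-deleteEdge {e₀} {e} e≢e₀ = cong not (dec-false (e FinP.≟ e₀) e≢e₀)

  signColoring-whole : ∀ s e₀ → (∀ e → e ≢ e₀ → Respects s e) → Respects s e₀ →
                       SignColoring (whole G) s
  signColoring-whole s e₀ others at-e₀ e _ with e FinP.≟ e₀
  ... | yes refl  = at-e₀
  ... | no  e≢e₀ = others e e≢e₀

  UnbalancedClosedWalk : Set
  UnbalancedClosedWalk = Σ V λ a → Σ (Walk (whole G) a a) λ w → walkSign w ≡ Sign.-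

  signCritical⇒unbalancedClosedWalk : SignCritical → UnbalancedClosedWalk
  signCritical⇒unbalancedClosedWalk (not-colorable , proper-colorable) with Fin? (m G)
  ... | no  edgeless = ⊥-elim (not-colorable ((λ _ → Sign.+) , λ e _ → ⊥-elim (edgeless e)))
  ... | yes e₀ with proper-colorable (deleteEdge e₀) (deleteEdge-proper e₀)
  ... | s , s-ok with s (fst e₀) Sign.≟ antisign e₀ * s (snd e₀)
  ... | yes e₀-ok =
    ⊥-elim (not-colorable (s , signColoring-whole s e₀ (λ e e≢e₀ → s-ok e (∈-deleteEdge e≢e₀)) e₀-ok))
  ... | no  e₀-bad with walk⊎separator (deleteEdge e₀) (snd e₀) (fst e₀)
  ... | inj₁ w =
    fst e₀ , step e₀ refl (inj₁ (refl , refl)) (weaken w) ,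
    trans (cong (antisign e₀ *_) (walkSign-weaken w))
          (unbalanced-closing (antisign e₀) (walkSign w) (walkSign-respected {s = s} s-ok w) e₀-bad)
  ... | inj₂ (S , snd∈S , fst∉S , no-cross) =
    ⊥-elim (not-colorable (switch S s , signColoring-whole (switch S s) e₀
      (λ e e≢e₀ → switch-respects S s e (s-ok e (∈-deleteEdge e≢e₀)) (no-cross e (∈-deleteEdge e≢e₀)))
      (switch-repairs S s e₀ e₀-bad (inj₂ (snd∈S , fst∉S)))))

  -- Windings and cycles

  Winds : ∀ {ℓ} → (Fin ℓ → V) → (Fin ℓ → E) → Set
  Winds p q = ∀ i → Joins (ends G (q i)) (p i) (p (nextMod i))

  closedWalk-winds : ∀ {H a} (w : Walk H a a) → Winds (vertexAt w ∘ toℕ) (edgeAt w)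
  closedWalk-winds w i = subst (Joins (ends G (edgeAt w i)) (vertexAt w (toℕ i)))
    (sym (nextMod-periodic (vertexAt w) (trans (vertexAt-length w) (sym (vertexAt-0 w))) i))
    (edgeAt-joins w i)

  winding-length : ∀ {ℓ} {p : Fin ℓ → V} {q : Fin ℓ → E} → Winds p q →
                   ∏ (antisign ∘ q) ≡ Sign.- → 2 ≤ ℓ
  winding-length {zero}                    _     ()
  winding-length {suc zero} {q = q} winds _ with winds zero
  ... | inj₁ (fst≡ , snd≡) = contradiction (trans fst≡ (sym snd≡)) (noLoop G (q zero))
  ... | inj₂ (fst≡ , snd≡) = contradiction (trans fst≡ (sym snd≡)) (noLoop G (q zero))
  winding-length {suc (suc _)}             _     _ = s≤s (s≤s z≤n)

  module _ {ℓ} {p : Fin ℓ → V} {q : Fin ℓ → E} (winds : Winds p q) where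

    winding-balanced : ∀ {s} → (∀ i → Respects s (q i)) → ∏ (antisign ∘ q) ≡ Sign.+
    winding-balanced {s} s-ok = sym (SignP.*-cancelʳ-≡ (∏ (s ∘ p)) Sign.+ (∏ (antisign ∘ q)) (begin
      ∏ (s ∘ p)
        ≡⟨ sum-cong-≗ (λ i → respects-joins {s = s} (s-ok i) (winds i)) ⟩
      ∏ (λ i → antisign (q i) * s (p (nextMod i)))
        ≡⟨ ∑-distrib-+ (antisign ∘ q) (s ∘ p ∘ nextMod) ⟩
      ∏ (antisign ∘ q) * ∏ (s ∘ p ∘ nextMod)
        ≡⟨ cong (∏ (antisign ∘ q) *_) (∏-nextMod (s ∘ p)) ⟩
      ∏ (antisign ∘ q) * ∏ (s ∘ p)
        ∎))
      where open ≡-Reasoning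

    winding-injective : Injective _≡_ _≡_ p → ∏ (antisign ∘ q) ≡ Sign.- → Injective _≡_ _≡_ q
    winding-injective p-inj unbalanced {i} {j} qi≡qj with i FinP.≟ j
    ... | yes i≡j = i≡j
    ... | no  i≢j
      with joins-unique (subst (λ e → Joins (ends G e) (p i) (p (nextMod i))) qi≡qj (winds i)) (winds j)
    ... | inj₁ (pi≡pj , _) = contradiction (p-inj pi≡pj) i≢j
    ... | inj₂ (pi≡pj⁺ , pi⁺≡pj) = contradiction (trans (sym balanced) unbalanced) λ ()
      where
      -- the only way to traverse an edge twice in opposite directions is a cycle of length 2
      ℓ≡2 : ℓ ≡ 2
      ℓ≡2 = ℕP.≤-antisym
        (nextMod²≡id⇒ℓ≤2 i (trans (cong nextMod (p-inj pi⁺≡pj)) (sym (p-inj pi≡pj⁺))))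
        (winding-length winds unbalanced)
      balanced : ∏ (antisign ∘ q) ≡ Sign.+
      balanced = ∏-repeated (antisign ∘ q) ℓ≡2 i≢j (cong antisign qi≡qj)

    traced : Subgraph G
    traced = record { vs = visited ; es = traversed ; closed = traversed-closed }
      where
      visited : V → Bool
      visited v = does (FinP.any? λ i → p i FinP.≟ v)
      traversed : E → Bool
      traversed e = does (FinP.any? λ i → q i FinP.≟ e)
      visits : ∀ {v} → ∃ (λ i → p i ≡ v) → visited v ≡ true
      visits = dec-true (FinP.any? _)
      traversed-closed : ∀ e → traversed e ≡ true → visited (fst e) ≡ true × visited (snd e) ≡ true
      traversed-closed e e∈ with does-true (FinP.any? λ i → q i FinP.≟ e) e∈
      ... | i , refl with winds i
      ... | inj₁ (fst≡ , snd≡) = visits (i , sym fst≡) , visits (nextMod i , sym snd≡)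
      ... | inj₂ (fst≡ , snd≡) = visits (nextMod i , sym fst≡) , visits (i , sym snd≡)

    traversed : ∀ i → es traced (q i) ≡ true
    traversed i = dec-true (FinP.any? _) (i , refl)

    traced-surjective : ¬ Proper traced → Surjective _≡_ _≡_ p × Surjective _≡_ _≡_ q
    traced-surjective not-proper =
      (λ v → onto (does-true (FinP.any? _) (¬-not λ v∉ → not-proper (inj₁ (v , v∉))))) ,
      (λ e → onto (does-true (FinP.any? _) (¬-not λ e∉ → not-proper (inj₂ (e , e∉)))))
      where
      onto : ∀ {A : Set} {f : Fin ℓ → A} {y} → (∃ λ i → f i ≡ y) → ∃ λ i → ∀ {j} → j ≡ i → f j ≡ y
      onto (i , fi≡y) = i , λ { refl → fi≡y }

  winding-not-signColorable : ∀ {ℓ} {p : Fin ℓ → V} {q : Fin ℓ → E} → Winds p q →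
                              ∏ (antisign ∘ q) ≡ Sign.- →
                              ∀ {H} → (∀ i → es H (q i) ≡ true) → ¬ SignColorable H
  winding-not-signColorable {q = q} winds unbalanced q∈H (s , s-ok) =
    contradiction (trans (sym (winding-balanced winds {s} (λ i → s-ok (q i) (q∈H i)))) unbalanced) λ ()

  cycle-antisign : ∀ {ℓ} {q : Fin ℓ → E} → Bijective _≡_ _≡_ q →
                   ∏ (antisign ∘ q) ≡ -^ ℓ * signProduct G
  cycle-antisign {ℓ} {q} q-bij = begin
    ∏ (antisign ∘ q)       ≡⟨ ∏-opposite (sign G ∘ q) ⟩
    -^ ℓ * ∏ (sign G ∘ q)  ≡⟨ cong (-^ ℓ *_) (∏-bijection (sign G) q-bij) ⟩
    -^ ℓ * ∏ (sign G)      ≡⟨ cong (-^ ℓ *_) (signProduct≡∏ G) ⟨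
    -^ ℓ * signProduct G   ∎
    where open ≡-Reasoning

  Unbalanced⁻Cycle : Set
  Unbalanced⁻Cycle = Σ ℕ λ ℓ → IsCycleOfLength G ℓ × -^ ℓ * signProduct G ≡ Sign.-

  critical⇒unbalanced⁻Cycle : Critical 3 G → Unbalanced⁻Cycle
  critical⇒unbalanced⁻Cycle critical
    with signCritical⇒unbalancedClosedWalk (critical⇒signCritical critical)
  ... | _ , w , w- with simpleUnbalanced w w-
  ... | _ , c , c- , c-simple =
    length c , (winding-length winds unbalanced , p , (c-simple , p-onto) , q , (q-inj , q-onto) , winds) ,
    trans (sym (cycle-antisign (q-inj , q-onto))) unbalanced
    where
    p : Fin (length c) → V
    p = vertexAt c ∘ toℕ
    q : Fin (length c) → E
    q = edgeAt c
    winds : Winds p q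
    winds = closedWalk-winds c
    unbalanced : ∏ (antisign ∘ q) ≡ Sign.-
    unbalanced = trans (sym (walkSign≡∏ c)) c-
    not-proper : ¬ Proper (traced winds)
    not-proper proper = winding-not-signColorable winds unbalanced {traced winds} (traversed winds)
                          (proj₂ (critical⇒signCritical critical) (traced winds) proper)
    p-onto : Surjective _≡_ _≡_ p
    p-onto = proj₁ (traced-surjective winds not-proper)
    q-onto : Surjective _≡_ _≡_ q
    q-onto = proj₂ (traced-surjective winds not-proper)
    q-inj : Injective _≡_ _≡_ q
    q-inj = winding-injective winds c-simple unbalanced

  zeroAt-colorable : ∀ v₀ s → (∀ e → fst e ≢ v₀ → snd e ≢ v₀ → Respects s e) → Colorable (whole G) 3
  zeroAt-colorable v₀ s s-ok = φ , (λ v _ → φ∈Z v) , φ-ok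
    where
    φ : V → ℤ
    φ v = if does (v FinP.≟ v₀) then 0ℤ else ⟦ s v ⟧
    φ∈Z : ∀ v → InZ 3 (φ v)
    φ∈Z v with v FinP.≟ v₀
    ... | yes _ = 0-InZ-3
    ... | no  _ = ⟦⟧-InZ-3 (s v)
    φ-ok : ∀ e → es (whole G) e ≡ true → φ (fst e) ≢ ⟦ sign G e ⟧ ℤ.* φ (snd e)
    φ-ok e _ with fst e FinP.≟ v₀ | snd e FinP.≟ v₀
    ... | yes u≡v₀ | yes v≡v₀ = contradiction (trans u≡v₀ (sym v≡v₀)) (noLoop G e)
    ... | yes _    | no  _    = λ eq → ⟦⟧≢0 _ (sym (trans eq (sym (⟦⟧-* (sign G e) (s (snd e))))))
    ... | no  _    | yes _    = λ eq → ⟦⟧≢0 _ (trans eq (ℤP.*-zeroʳ ⟦ sign G e ⟧))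
    ... | no  u≢v₀ | no  v≢v₀ = λ eq →
      Equivalence.from (≢*⇔≡opposite* _ (sign G e) _) (s-ok e u≢v₀ v≢v₀)
        (⟦⟧-injective (trans eq (sym (⟦⟧-* (sign G e) (s (snd e))))))

  module _ {ℓ} {p : Fin ℓ → V} {q : Fin ℓ → E} (winds : Winds p q) (p-bij : Bijective _≡_ _≡_ p)
    where

    open Inverse (⤖⇒↔ (mk⤖ p-bij)) using () renaming (from to p⁻¹; strictlyInverseʳ to p⁻¹-p)

    antisignPath : ℕ → Fin ℓ → Sign
    antisignPath zero    i = Sign.+
    antisignPath (suc d) i = antisign (q i) * antisignPath d (nextMod i)

    -- p i gets the −σ-product of the path from p i forward to p k, which avoids the edge q k
    gapColoring : Fin ℓ → V → Sign
    gapColoring k v = antisignPath (gap k (p⁻¹ v)) (p⁻¹ v)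

    gapColoring-respects : ∀ k i → i ≢ k → Respects (gapColoring k) (q i)
    gapColoring-respects k i i≢k = joins⇒respects {s = gapColoring k} (winds i) (begin
      gapColoring k (p i)                             ≡⟨ cong c (p⁻¹-p i) ⟩
      c i                                             ≡⟨ cong (λ d → antisignPath d i) (gap-nextMod k i i≢k) ⟩
      antisign (q i) * c (nextMod i)                  ≡⟨ cong (λ j → antisign (q i) * c j) (p⁻¹-p _) ⟨
      antisign (q i) * gapColoring k (p (nextMod i))  ∎)
      where
      open ≡-Reasoning
      c : Fin ℓ → Sign
      c j = antisignPath (gap k j) j

  joins-visited : ∀ {H : Subgraph G} {e a b} → es H e ≡ true → Joins (ends G e) a b → vs H a ≡ true
  joins-visited {H} e∈H (inj₁ (refl , _)) = proj₁ (closed H _ e∈H)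
  joins-visited {H} e∈H (inj₂ (_ , refl)) = proj₂ (closed H _ e∈H)

  proper-misses-edge : ∀ {ℓ} {p : Fin ℓ → V} {q : Fin ℓ → E} → Winds p q →
                       Surjective _≡_ _≡_ p → Surjective _≡_ _≡_ q →
                       ∀ {H} → Proper H → ∃ λ k → es H (q k) ≡ false
  proper-misses-edge _ _ q-onto {H} (inj₂ (e , e∉H)) with q-onto e
  ... | k , qk≡e = k , trans (cong (es H) (qk≡e refl)) e∉H
  proper-misses-edge winds p-onto _ {H} (inj₁ (v , v∉H)) with p-onto v
  ... | k , pk≡v = k , ¬-not λ qk∈H → contradiction
    (trans (sym v∉H) (trans (cong (vs H) (sym (pk≡v refl))) (joins-visited {H} qk∈H (winds k)))) λ ()

  unbalanced⁻Cycle⇒critical : Unbalanced⁻Cycle → Critical 3 G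
  unbalanced⁻Cycle⇒critical (_ , (s≤s (s≤s _) , p , p-bij , q , q-bij , winds) , cycle-) =
    (three-colorable , not-two-colorable) , proper-two-colorable
    where
    open Inverse (⤖⇒↔ (mk⤖ q-bij)) using () renaming (from to q⁻¹; strictlyInverseˡ to q-q⁻¹)

    unbalanced : ∏ (antisign ∘ q) ≡ Sign.-
    unbalanced = trans (cycle-antisign q-bij) cycle-

    not-two-colorable : ∀ j → j < 3 → ¬ Colorable (whole G) j
    not-two-colorable j j<3 colorable = winding-not-signColorable winds unbalanced {whole G} (λ _ → refl)
      (colorable⇒signColorable {whole G} (ℕP.≤-pred j<3) colorable)

    respects-other-edges : ∀ k e → q⁻¹ e ≢ k → Respects (gapColoring winds p-bij k) e
    respects-other-edges k e e≢qk = subst (Respects (gapColoring winds p-bij k)) (q-q⁻¹ e)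
      (gapColoring-respects winds p-bij k (q⁻¹ e) e≢qk)

    avoids-q₀ : ∀ e → fst e ≢ p zero → snd e ≢ p zero → q⁻¹ e ≢ zero
    avoids-q₀ e u≢p₀ v≢p₀ e≡q₀
      with subst (λ e → Joins (ends G e) (p zero) (p (nextMod zero))) (trans (cong q (sym e≡q₀)) (q-q⁻¹ e))
                 (winds zero)
    ... | inj₁ (u≡p₀ , _) = u≢p₀ u≡p₀
    ... | inj₂ (_ , v≡p₀) = v≢p₀ v≡p₀

    three-colorable : Colorable (whole G) 3
    three-colorable = zeroAt-colorable (p zero) (gapColoring winds p-bij zero)
      λ e u≢p₀ v≢p₀ → respects-other-edges zero e (avoids-q₀ e u≢p₀ v≢p₀)

    proper-two-colorable : ∀ H → Proper H → ChiLe H 2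
    proper-two-colorable H proper with proper-misses-edge winds (proj₂ p-bij) (proj₂ q-bij) {H} proper
    ... | k , qk∉H = 2 , ℕP.≤-refl , ⟦_⟧ ∘ gapColoring winds p-bij k , signColoring⇒coloring {H} λ e e∈H →
      respects-other-edges k e λ { refl →
        contradiction (trans (sym qk∉H) (trans (cong (es H) (q-q⁻¹ e)) e∈H)) λ () }

  unbalanced⁻Cycle⇔ : Unbalanced⁻Cycle ⇔ (BalancedOddCycle G ⊎ UnbalancedEvenCycle G)
  unbalanced⁻Cycle⇔ = mk⇔ classify declassify
    where
    classify : Unbalanced⁻Cycle → BalancedOddCycle G ⊎ UnbalancedEvenCycle G
    classify (ℓ , cycle , cycle-) with Equivalence.to (-^*≡-⇔ ℓ (signProduct G)) cycle-
    ... | inj₁ (odd , balanced)    = inj₁ (balanced , ℓ , cycle , odd)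
    ... | inj₂ (even , unbalanced) = inj₂ (unbalanced , ℓ , cycle , even)
    declassify : BalancedOddCycle G ⊎ UnbalancedEvenCycle G → Unbalanced⁻Cycle
    declassify (inj₁ (balanced , ℓ , cycle , odd)) =
      ℓ , cycle , Equivalence.from (-^*≡-⇔ ℓ (signProduct G)) (inj₁ (odd , balanced))
    declassify (inj₂ (unbalanced , ℓ , cycle , even)) =
      ℓ , cycle , Equivalence.from (-^*≡-⇔ ℓ (signProduct G)) (inj₂ (even , unbalanced))

lemma13 : (G : SignedGraph) →
    Critical 3 G ⇔ (BalancedOddCycle G ⊎ UnbalancedEvenCycle G)
lemma13 G = ⇔-trans (mk⇔ (critical⇒unbalanced⁻Cycle G) (unbalanced⁻Cycle⇒critical G))
                    (unbalanced⁻Cycle⇔ G)
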